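{- Let $(M,A)$ be a $d$-dimensional BUT-manifold. Let $\{B_i,B_{ -i}\}$, $i=1,\ldots,d+1$, be a family of closed subsets of $M$ with $B_{ -i}=A(B_i)$ and $B_i\cap B_{ -i}=\emptyset$ for all $i$. If this family covers $M$, then for every set of indices $\{k_1,\ldots,k_{d+1}\}\subset\{\pm1,\pm2,\ldots,\pm(d+1)\}$ with $|k_i|=i$ for all $i$, the intersection $\bigcap_{i=1}^{d+1}B_{k_i}$ is nonempty.
   Context: A BUT (Borsuk–Ulam type) manifold is a pair $(M,A)$ where $M$ is a connected compact piecewise-linear $d$-dimensional manifold without boundary and $A:M\to M$ is a free simplicial involution ($A(A(x))=x$, $A(x)\neq x$), such that for every continuous $g:M\to\mathbb{R}^d$ there is $x\in M$ with $g(A(x))=g(x)$. -}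

module Defs where

open import Level using (0ℓ)
open import Algebra.Bundles using (CommutativeRing)
import Algebra.Properties.CommutativeMonoid.Sum as CommutativeMonoidSum
open import Data.Bool using (if_then_else_)
open import Data.Fin using (Fin; _≟_)
import Data.Fin.Subset as Sub
open Sub using (Subset; ⁅_⁆)
open import Data.Nat using (ℕ)
open import Data.Product using (∃; ∃-syntax; _×_; _,_; proj₁; proj₂)
open import Data.Sign using (Sign)
open import Data.Sum using (_⊎_)
open import Data.Vec.Functional using (Vector)
import Data.Vec.Functional.Relation.Binary.Equality.Setoid as VectorEquality
open import Function.Bundles using (_⇔_)
open import Relation.Binary using (Rel; IsTotalOrder)
open import Relation.Binary.PropositionalEquality using (_≡_)
open import Relation.Nullary using (¬_)
open import Relation.Nullary.Decidable using (does)
open import Relation.Unary using (Pred; _∈_; _⊆_)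

-- The real numbers, axiomatised as a Dedekind-complete ordered field.  All
-- definitions below are read classically: the theorem assumes excluded middle.
record CompleteOrderedField : Set₁ where
  field
    commutativeRing : CommutativeRing 0ℓ 0ℓ

  open CommutativeRing commutativeRing public

  infix 4 _≤_ _<_

  field
    _≤_          : Rel Carrier 0ℓ
    isTotalOrder : IsTotalOrder _≈_ _≤_
    0≉1          : ¬ (0# ≈ 1#)
    inverse      : ∀ x → ¬ (x ≈ 0#) → ∃[ y ] x * y ≈ 1#
    +-monoʳ-≤    : ∀ x {y z} → y ≤ z → x + y ≤ x + z
    *-nonNeg     : ∀ {x y} → 0# ≤ x → 0# ≤ y → 0# ≤ x * y

  UpperBound : Pred Carrier 0ℓ → Pred Carrier 0ℓ
  UpperBound P b = ∀ x → x ∈ P → x ≤ b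

  field
    supremum : (P : Pred Carrier 0ℓ) → ∃ P → ∃ (UpperBound P) →
               ∃[ s ] UpperBound P s × (∀ b → UpperBound P b → s ≤ b)

  _<_ : Rel Carrier 0ℓ
  x < y = x ≤ y × ¬ (x ≈ y)

-- The indices ±1, …, ±m; the element i of Fin m stands for the number i + 1.
SignedIndex : ℕ → Set
SignedIndex m = Sign × Fin m

absolute : ∀ {m} → SignedIndex m → Fin m
absolute = proj₂

-- Abstract simplicial complex whose set of vertices is exactly Fin n.
record SimplicialComplex (n : ℕ) : Set₁ where
  field
    Face        : Pred (Subset n) 0ℓ
    nonempty    : ∀ {σ} → Face σ → Sub.Nonempty σ
    vertices    : ∀ v → Face ⁅ v ⁆
    down-closed : ∀ {σ τ} → Face τ → σ Sub.⊆ τ → Sub.Nonempty σ → Face σ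

module Geometry (ℝ : CompleteOrderedField) where
  open CompleteOrderedField ℝ
  open CommutativeMonoidSum +-commutativeMonoid using (sum)
  open VectorEquality setoid using (_≋_)

  ℝ^_ : ℕ → Set
  ℝ^ n = Vector Carrier n

  -- A subset of ℝⁿ regarded as a space in its own right; its points are
  -- identified when their coordinates are, see _≃_.
  Space : ∀ {n} → Pred (ℝ^ n) 0ℓ → Set
  Space X = ∃ X

  infix 4 _≃_

  _≃_ : ∀ {n} {X : Pred (ℝ^ n) 0ℓ} → Rel (Space X) 0ℓ
  (x , _) ≃ (y , _) = x ≋ y

  -- ‖ x - y ‖ < ε for the maximum norm, which induces the usual topology of ℝⁿ.
  Close : ∀ {n} → Carrier → Rel (ℝ^ n) 0ℓ
  Close ε x y = ∀ i → (x i - y i < ε) × (y i - x i < ε)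

  module _ {n : ℕ} {X : Pred (ℝ^ n) 0ℓ} where

    IsOpen : Pred (Space X) 0ℓ → Set
    IsOpen U = ∀ x → U x →
      ∃[ ε ] 0# < ε × (∀ y → Close ε (proj₁ x) (proj₁ y) → U y)

    IsClosed : Pred (Space X) 0ℓ → Set
    IsClosed B = IsOpen (λ x → ¬ B x)

    IsContinuous : ∀ {m} → (Space X → ℝ^ m) → Set
    IsContinuous g = ∀ x ε → 0# < ε →
      ∃[ δ ] 0# < δ × (∀ y → Close δ (proj₁ x) (proj₁ y) → Close ε (g x) (g y))

    image : (Space X → Space X) → Pred (Space X) 0ℓ → Pred (Space X) 0ℓ
    image f B y = ∃[ x ] B x × f x ≃ y

  IsConnected : ∀ {n} → Pred (ℝ^ n) 0ℓ → Set₁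
  IsConnected X = (U V : Pred (Space X) 0ℓ) → IsOpen U → IsOpen V →
    (∀ x → U x ⊎ V x) → ∃ U → ∃ V → ∃[ x ] U x × V x

  IsWeight : ∀ {k} → Pred (ℝ^ k) 0ℓ
  IsWeight t = (∀ j → 0# ≤ t j) × sum t ≈ 1#

  combination : ∀ {k n} → ℝ^ k → (Fin k → ℝ^ n) → ℝ^ n
  combination t p i = sum (λ j → t j * p j i)

  -- X is a finite union of convex polytopes (so in particular X is a compact
  -- polyhedron), the i-th being the convex hull of the points `points i`, and
  -- f is affine on each of them, sending `points i j` to `values i j`.
  record IsPiecewiseLinear {n m} (X : Pred (ℝ^ n) 0ℓ) (f : Space X → ℝ^ m) : Set where
    field
      pieces : ℕ
      size   : Fin pieces → ℕ
      points : ∀ i → Fin (size i) → ℝ^ n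
      values : ∀ i → Fin (size i) → ℝ^ m
      inside : ∀ i t → IsWeight t → X (combination t (points i))
      covers : ∀ x → X x → ∃[ i ] ∃[ t ] IsWeight t × x ≋ combination t (points i)
      affine : ∀ i t (x : Space X) → IsWeight t →
               proj₁ x ≋ combination t (points i) → f x ≋ combination t (values i)

  record PLHomeomorphism {n m} (X : Pred (ℝ^ n) 0ℓ) (Y : Pred (ℝ^ m) 0ℓ) : Set where
    field
      to      : Space X → Space Y
      from    : Space Y → Space X
      to-PL   : IsPiecewiseLinear X (λ x → proj₁ (to x))
      from-PL : IsPiecewiseLinear Y (λ y → proj₁ (from y))
      to-from : ∀ y → to (from y) ≃ y
      from-to : ∀ x → from (to x) ≃ x

  Cube : ∀ d → Pred (ℝ^ d) 0ℓ
  Cube d y = ∀ j → (- 1# ≤ y j) × (y j ≤ 1#)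

  -- A chart at an interior point of a PL manifold: a neighbourhood of x in X
  -- with a PL homeomorphism onto the cube [-1,1]ᵈ that takes x to the centre.
  record PLChart {n} (d : ℕ) (X : Pred (ℝ^ n) 0ℓ) (x : Space X) : Set₁ where
    field
      N             : Pred (ℝ^ n) 0ℓ
      N⊆X           : N ⊆ X
      x∈N           : N (proj₁ x)
      neighbourhood : ∃[ ε ] 0# < ε × (∀ y → X y → Close ε (proj₁ x) y → N y)
      chart         : PLHomeomorphism N (Cube d)
      centred       : proj₁ (PLHomeomorphism.to chart (proj₁ x , x∈N)) ≋ (λ _ → 0#)

  -- Geometric realisation, in barycentric coordinates.
  ∥_∥ : ∀ {n} → SimplicialComplex n → Pred (ℝ^ n) 0ℓ
  ∥ K ∥ t = IsWeight t × (∃[ σ ] SimplicialComplex.Face K σ × (∀ v → v Sub.∉ σ → t v ≈ 0#))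

  record IsSimplicialMap {n m} (K : SimplicialComplex n) (L : SimplicialComplex m)
                         (f : Space ∥ K ∥ → Space ∥ L ∥) : Set where
    private
      module K = SimplicialComplex K
      module L = SimplicialComplex L
    field
      vertexMap : Fin n → Fin m
      faces     : ∀ {σ} → K.Face σ →
                  ∃[ τ ] L.Face τ × (∀ w → w Sub.∈ τ ⇔ (∃[ v ] v Sub.∈ σ × vertexMap v ≡ w))
      linear    : ∀ x w → proj₁ (f x) w ≈
                  sum (λ v → if does (vertexMap v ≟ w) then proj₁ x v else 0#)

  -- Connected compact PL d-manifold without boundary, with a triangulation.
  -- Compactness is the finiteness of the complex; there is no boundary since
  -- every point is the centre of a chart.
  record PLManifold (d : ℕ) : Set₁ where
    field
      {vertexCount} : ℕ
      complex       : SimplicialComplex vertexCount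
      connected     : IsConnected ∥ complex ∥
      charts        : ∀ x → PLChart d ∥ complex ∥ x

    Point : Set
    Point = Space ∥ complex ∥

  record BUTManifold (d : ℕ) : Set₁ where
    field
      M : PLManifold d

    open PLManifold M public

    field
      A          : Point → Point
      simplicial : IsSimplicialMap complex complex A
      involutive : ∀ x → A (A x) ≃ x
      free       : ∀ x → ¬ (A x ≃ x)
      borsukUlam : (g : Point → ℝ^ d) → IsContinuous g → ∃[ x ] g (A x) ≋ g x

{-# OPTIONS --safe #-}
-- Let aᵢ(x) be a truncated distance from x to Cᵢ = B(kᵢ), and apply the
-- Borsuk–Ulam property to the map g with coordinates
-- gᵢ(x) = min(aᵢ(x), aᵢ₊₁(A x)), i = 1, …, d.  At a point with g(A x) = g(x),
-- comparing zeros gives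
--   A x ∈ Cᵢ or x ∈ Cᵢ₊₁   if and only if   x ∈ Cᵢ or A x ∈ Cᵢ₊₁.
-- As x and A x never both lie in Cᵢ, membership of x in one Cⱼ propagates to
-- the neighbouring indices, hence to all of them, and likewise for A x.  Since
-- the sets cover, x or A x lies in some Cⱼ.
module Submission where

open import Defs
open import Level using (0ℓ)
open import Axiom.ExcludedMiddle using (ExcludedMiddle)
import Algebra.Construct.NaturalChoice.Min as NaturalMin
import Algebra.Properties.CommutativeMonoid.Sum as CommutativeMonoidSum
import Algebra.Properties.CommutativeSemigroup as CommutativeSemigroupProperties
import Algebra.Properties.Ring as RingProperties
open import Data.Bool using (Bool; true; false; if_then_else_)
open import Data.Fin using (Fin; zero; suc; inject₁; _≟_)
open import Data.Nat using (ℕ; zero; suc)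
open import Data.Product using (∃-syntax; _×_; _,_; proj₁; proj₂; swap)
open import Data.Sign using (Sign; opposite)
open import Data.Sum as Sum using (_⊎_; inj₁; inj₂; fromInj₁; fromInj₂)
open import Function using (_∘_)
open import Function.Bundles using (_⇔_; mk⇔; Equivalence)
open import Relation.Binary using (TotalOrder)
import Relation.Binary.Properties.TotalOrder as TotalOrderProperties
import Relation.Binary.Reasoning.PartialOrder as PartialOrderReasoning
open import Relation.Binary.PropositionalEquality using (_≡_; subst) renaming (sym to ≡-sym)
open import Relation.Nullary using (¬_; contradiction)
open import Relation.Nullary.Decidable using (does; decidable-stable)
open import Relation.Unary using (Pred; _≐_)

-- Arithmetic of ordered fields: halving, minima and finite sums.

module OrderedFieldProperties (ℝ : CompleteOrderedField) where
  open CompleteOrderedField ℝ hiding (zero)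

  totalOrder : TotalOrder 0ℓ 0ℓ 0ℓ
  totalOrder = record { isTotalOrder = isTotalOrder }

  module ≤ = TotalOrder totalOrder
  open TotalOrderProperties totalOrder using (≰⇒>; <⇒≱; <-respʳ-≈) public
  open NaturalMin totalOrder using (_⊓_; ⊓-sel; ⊓-glb; x⊓y≤x; x⊓y≤y) public
  open RingProperties ring
    using (+-cancelˡ; //-rightDividesˡ; //-rightDividesʳ; -‿distribʳ-*; -‿involutive)
  open CommutativeSemigroupProperties +-commutativeSemigroup using (interchange)
  open CommutativeMonoidSum +-commutativeMonoid using (sum)
  open PartialOrderReasoning ≤.poset

  +-monoˡ-≤ : ∀ x {y z} → y ≤ z → y + x ≤ z + x
  +-monoˡ-≤ x {y} {z} y≤z = begin
    y + x  ≈⟨ +-comm y x ⟩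
    x + y  ≤⟨ +-monoʳ-≤ x y≤z ⟩
    x + z  ≈⟨ +-comm x z ⟩
    z + x  ∎

  +-monoʳ-< : ∀ x {y z} → y < z → x + y < x + z
  +-monoʳ-< x {y} {z} (y≤z , y≉z) = +-monoʳ-≤ x y≤z , y≉z ∘ +-cancelˡ x y z

  +-monoˡ-< : ∀ x {y z} → y < z → y + x < z + x
  +-monoˡ-< x {y} {z} y<z = begin-strict
    y + x  ≈⟨ +-comm y x ⟩
    x + y  <⟨ +-monoʳ-< x y<z ⟩
    x + z  ≈⟨ +-comm x z ⟩
    z + x  ∎

  +-mono-< : ∀ {x y z w} → x < y → z < w → x + z < y + w
  +-mono-< {x} {y} {z} {w} x<y z<w = begin-strict
    x + z  <⟨ +-monoˡ-< z x<y ⟩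
    y + z  <⟨ +-monoʳ-< y z<w ⟩
    y + w  ∎

  x<y+x : ∀ x {y} → 0# < y → x < y + x
  x<y+x x {y} 0<y = begin-strict
    x       ≈⟨ +-identityˡ x ⟨
    0# + x  <⟨ +-monoˡ-< x 0<y ⟩
    y + x   ∎

  x-y<z⇒x<z+y : ∀ {x y z} → x - y < z → x < z + y
  x-y<z⇒x<z+y {x} {y} {z} p = begin-strict
    x          ≈⟨ //-rightDividesˡ y x ⟨
    x - y + y  <⟨ +-monoˡ-< y p ⟩
    z + y      ∎

  x<z+y⇒x-y<z : ∀ {x y z} → x < z + y → x - y < z
  x<z+y⇒x-y<z {x} {y} {z} p = begin-strict
    x - y      <⟨ +-monoˡ-< (- y) p ⟩
    z + y - y  ≈⟨ //-rightDividesʳ y z ⟩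
    z          ∎

  x-y≤z⇒x≤z+y : ∀ {x y z} → x - y ≤ z → x ≤ z + y
  x-y≤z⇒x≤z+y {x} {y} {z} p = begin
    x          ≈⟨ //-rightDividesˡ y x ⟨
    x - y + y  ≤⟨ +-monoˡ-≤ y p ⟩
    z + y      ∎

  x≤z+y⇒x-y≤z : ∀ {x y z} → x ≤ z + y → x - y ≤ z
  x≤z+y⇒x-y≤z {x} {y} {z} p = begin
    x - y      ≤⟨ +-monoˡ-≤ (- y) p ⟩
    z + y - y  ≈⟨ //-rightDividesʳ y z ⟩
    z          ∎

  x≤0⇒0≤-x : ∀ {x} → x ≤ 0# → 0# ≤ - x
  x≤0⇒0≤-x {x} x≤0 = begin
    0#      ≈⟨ -‿inverseʳ x ⟨
    x - x   ≤⟨ +-monoˡ-≤ (- x) x≤0 ⟩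
    0# - x  ≈⟨ +-identityˡ (- x) ⟩
    - x     ∎

  -- If 1 ≤ 0, then -1 is nonnegative, and 1 is the square of -1.
  0<1 : 0# < 1#
  0<1 with ≤.total 0# 1#
  ... | inj₁ 0≤1 = 0≤1 , 0≉1
  ... | inj₂ 1≤0 = 0≤1 , 0≉1
    where
    0≤1 : 0# ≤ 1#
    0≤1 = begin
      0#             ≤⟨ *-nonNeg (x≤0⇒0≤-x 1≤0) (x≤0⇒0≤-x 1≤0) ⟩
      - 1# * - 1#    ≈⟨ -‿distribʳ-* (- 1#) 1# ⟨
      - (- 1# * 1#)  ≈⟨ -‿cong (*-identityʳ (- 1#)) ⟩
      - (- 1#)       ≈⟨ -‿involutive 1# ⟩
      1#             ∎

  0<2 : 0# < 1# + 1#
  0<2 = begin-strict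
    0#       <⟨ 0<1 ⟩
    1#       <⟨ x<y+x 1# 0<1 ⟩
    1# + 1#  ∎

  -- If y ≤ 0, then x * (-y) = -1 is nonnegative, and adding 1 yields 1 ≤ 0.
  inverse-nonNeg : ∀ {x y} → 0# ≤ x → x * y ≈ 1# → 0# ≤ y
  inverse-nonNeg {x} {y} 0≤x xy≈1 with ≤.total 0# y
  ... | inj₁ 0≤y = 0≤y
  ... | inj₂ y≤0 = contradiction 1≤0 (<⇒≱ 0<1)
    where
    1≤0 : 1# ≤ 0#
    1≤0 = begin
      1#                       ≈⟨ +-identityʳ 1# ⟨
      1# + 0#                  ≤⟨ +-monoʳ-≤ 1# (*-nonNeg 0≤x (x≤0⇒0≤-x y≤0)) ⟩
      1# + x * - y             ≈⟨ +-congˡ (-‿distribʳ-* x y) ⟨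
      1# - x * y               ≈⟨ +-congˡ (-‿cong xy≈1) ⟩
      1# - 1#                  ≈⟨ -‿inverseʳ 1# ⟩
      0#                       ∎

  half : ∀ {ε} → 0# < ε → ∃[ η ] 0# < η × η + η ≈ ε
  half {ε} (0≤ε , 0≉ε) with inverse (1# + 1#) (proj₂ 0<2 ∘ sym)
  ... | h , 2h≈1 = h * ε , (*-nonNeg 0≤h 0≤ε , 0≉hε) , hε+hε≈ε
    where
    0≤h : 0# ≤ h
    0≤h = inverse-nonNeg (proj₁ 0<2) 2h≈1

    hε+hε≈ε : h * ε + h * ε ≈ ε
    hε+hε≈ε = begin-equality
      h * ε + h * ε                ≈⟨ +-cong (*-identityˡ _) (*-identityˡ _) ⟨
      1# * (h * ε) + 1# * (h * ε)  ≈⟨ distribʳ (h * ε) 1# 1# ⟨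
      (1# + 1#) * (h * ε)          ≈⟨ *-assoc (1# + 1#) h ε ⟨
      (1# + 1#) * h * ε            ≈⟨ *-congʳ 2h≈1 ⟩
      1# * ε                       ≈⟨ *-identityˡ ε ⟩
      ε                            ∎

    0≉hε : ¬ (0# ≈ h * ε)
    0≉hε 0≈hε = 0≉ε (begin-equality
      0#             ≈⟨ +-identityˡ 0# ⟨
      0# + 0#        ≈⟨ +-cong 0≈hε 0≈hε ⟩
      h * ε + h * ε  ≈⟨ hε+hε≈ε ⟩
      ε              ∎)

  half< : ∀ {ε} → 0# < ε → ∃[ η ] 0# < η × η < ε
  half< {ε} 0<ε with half 0<ε
  ... | η , 0<η , η+η≈ε = η , 0<η , (begin-strict
    η      <⟨ x<y+x η 0<η ⟩
    η + η  ≈⟨ η+η≈ε ⟩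
    ε      ∎)

  0<x⊓y : ∀ {x y} → 0# < x → 0# < y → 0# < x ⊓ y
  0<x⊓y {x} {y} 0<x 0<y with ⊓-sel x y
  ... | inj₁ x⊓y≈x = begin-strict 0# <⟨ 0<x ⟩ x ≈⟨ x⊓y≈x ⟨ x ⊓ y ∎
  ... | inj₂ x⊓y≈y = begin-strict 0# <⟨ 0<y ⟩ y ≈⟨ x⊓y≈y ⟨ x ⊓ y ∎

  x⊓y≈0⇒x≈0⊎y≈0 : ∀ {x y} → x ⊓ y ≈ 0# → x ≈ 0# ⊎ y ≈ 0#
  x⊓y≈0⇒x≈0⊎y≈0 {x} {y} x⊓y≈0 with ⊓-sel x y
  ... | inj₁ x⊓y≈x = inj₁ (trans (sym x⊓y≈x) x⊓y≈0)
  ... | inj₂ x⊓y≈y = inj₂ (trans (sym x⊓y≈y) x⊓y≈0)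

  x≈0⊎y≈0⇒x⊓y≈0 : ∀ {x y} → 0# ≤ x → 0# ≤ y → x ≈ 0# ⊎ y ≈ 0# → x ⊓ y ≈ 0#
  x≈0⊎y≈0⇒x⊓y≈0 {x} {y} 0≤x 0≤y (inj₁ x≈0) =
    ≤.antisym (≤.trans (x⊓y≤x x y) (≤.reflexive x≈0)) (⊓-glb 0≤x 0≤y)
  x≈0⊎y≈0⇒x⊓y≈0 {x} {y} 0≤x 0≤y (inj₂ y≈0) =
    ≤.antisym (≤.trans (x⊓y≤y x y) (≤.reflexive y≈0)) (⊓-glb 0≤x 0≤y)

  -- Whichever of `x′`, `y′` attains the minimum on the right, the corresponding argument bounds the
  -- minimum on the left.
  ⊓-nonexpansive : ∀ {η x y x′ y′} → x ≤ η + x′ → y ≤ η + y′ → x ⊓ y ≤ η + x′ ⊓ y′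
  ⊓-nonexpansive {η} {x} {y} {x′} {y′} x≤ y≤ with ⊓-sel x′ y′
  ... | inj₁ min≈x′ = begin
    x ⊓ y          ≤⟨ x⊓y≤x x y ⟩
    x              ≤⟨ x≤ ⟩
    η + x′         ≈⟨ +-congˡ min≈x′ ⟨
    η + x′ ⊓ y′    ∎
  ... | inj₂ min≈y′ = begin
    x ⊓ y          ≤⟨ x⊓y≤y x y ⟩
    y              ≤⟨ y≤ ⟩
    η + y′         ≈⟨ +-congˡ min≈y′ ⟨
    η + x′ ⊓ y′    ∎

  -- The tolerance is halved once per summand: one half pays for the head, the other for the tail.
  -- The conjunct `δ ≤ ε` strengthens the induction, since the head must be bounded with the δ found
  -- for the tail.
  sum-continuous : ∀ n {ε} → 0# < ε →
    ∃[ δ ] 0# < δ × δ ≤ ε × ((f h : Fin n → Carrier) →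
      (∀ v → f v < δ + h v) → sum f < ε + sum h)
  sum-continuous zero    {ε} 0<ε = ε , 0<ε , ≤.refl , λ _ _ _ → x<y+x 0# 0<ε
  sum-continuous (suc n) {ε} 0<ε with half 0<ε
  ... | η , 0<η , η+η≈ε with sum-continuous n 0<η
  ... | δ , 0<δ , δ≤η , bound = δ , 0<δ , ≤.trans δ≤η η≤ε , bound′
    where
    η≤ε : η ≤ ε
    η≤ε = begin
      η      <⟨ x<y+x η 0<η ⟩
      η + η  ≈⟨ η+η≈ε ⟩
      ε      ∎

    bound′ : (f h : Fin (suc n) → Carrier) → (∀ v → f v < δ + h v) → sum f < ε + sum h
    bound′ f h f<δ+h = begin-strict
      f zero + sum (f ∘ suc)              <⟨ +-mono-< f₀< (bound (f ∘ suc) (h ∘ suc) (f<δ+h ∘ suc)) ⟩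
      (η + h zero) + (η + sum (h ∘ suc))  ≈⟨ interchange η (h zero) η (sum (h ∘ suc)) ⟩
      (η + η) + sum h                     ≈⟨ +-congʳ η+η≈ε ⟩
      ε + sum h                           ∎
      where
      f₀< : f zero < η + h zero
      f₀< = begin-strict
        f zero      <⟨ f<δ+h zero ⟩
        δ + h zero  ≤⟨ +-monoˡ-≤ (h zero) δ≤η ⟩
        η + h zero  ∎

-- Closeness in the maximum norm, closed sets and the truncated distance.

module Distance (em : ExcludedMiddle 0ℓ) (ℝ : CompleteOrderedField)
                {n : ℕ} {X : Pred (Geometry.ℝ^_ ℝ n) 0ℓ} where
  open CompleteOrderedField ℝ hiding (zero)
  open Geometry ℝ
  open OrderedFieldProperties ℝ
  open PartialOrderReasoning ≤.poset

  ≤-positive⇒≤0 : ∀ {r} → (∀ ε → 0# < ε → r ≤ ε) → r ≤ 0#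
  ≤-positive⇒≤0 r≤ = decidable-stable em λ r≰0 →
    let η , 0<η , η<r = half< (≰⇒> r≰0)
    in <⇒≱ η<r (r≤ η 0<η)

  Close-sym : ∀ {ε} {x y : ℝ^ n} → Close ε x y → Close ε y x
  Close-sym c i = swap (c i)

  Close-mono : ∀ {ε ε′} {x y : ℝ^ n} → ε ≤ ε′ → Close ε x y → Close ε′ x y
  Close-mono {ε} {ε′} ε≤ε′ c i = weaken (proj₁ (c i)) , weaken (proj₂ (c i))
    where
    weaken : ∀ {z} → z < ε → z < ε′
    weaken {z} z<ε = begin-strict z <⟨ z<ε ⟩ ε ≤⟨ ε≤ε′ ⟩ ε′ ∎

  Close-trans : ∀ {δ ε} {x y z : ℝ^ n} → Close δ x y → Close ε y z → Close (δ + ε) x z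
  Close-trans {δ} {ε} c c′ i =
    triangle (proj₁ (c i)) (proj₁ (c′ i)) ,
    <-respʳ-≈ (+-comm ε δ) (triangle (proj₂ (c′ i)) (proj₂ (c i)))
    where
    triangle : ∀ {α β a b e} → a - b < α → b - e < β → a - e < α + β
    triangle {α} {β} {a} {b} {e} p q = x<z+y⇒x-y<z (begin-strict
      a            <⟨ x-y<z⇒x<z+y p ⟩
      α + b        <⟨ +-monoʳ-< α (x-y<z⇒x<z+y q) ⟩
      α + (β + e)  ≈⟨ +-assoc α β e ⟨
      α + β + e    ∎)

  ≈⇒Close : ∀ {ε} → 0# < ε → {x y : ℝ^ n} → (∀ i → x i ≈ y i) → Close ε x y
  ≈⇒Close {ε} 0<ε x≃y i = near (x≃y i) , near (sym (x≃y i))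
    where
    near : ∀ {a b} → a ≈ b → a - b < ε
    near {a} {b} a≈b = x<z+y⇒x-y<z (begin-strict
      a      ≈⟨ a≈b ⟩
      b      <⟨ x<y+x b 0<ε ⟩
      ε + b  ∎)

  -- An arbitrary predicate on `Space X` may distinguish points with equal coordinates. A closed one
  -- cannot: a ball around `y` that misses `C` would contain `x`.
  IsClosed-resp-≃ : ∀ {C : Pred (Space X) 0ℓ} → IsClosed C → ∀ {x y} → x ≃ y → C x → C y
  IsClosed-resp-≃ closed {x} {y} x≃y x∈C = decidable-stable em λ y∉C →
    let ε , 0<ε , outside = closed y y∉C
    in outside x (≈⇒Close 0<ε (λ i → sym (x≃y i))) x∈C

  module _ (C : Pred (Space X) 0ℓ) where

    -- The supremum of these r is min(1, dist(x, C)) for the maximum norm, so the distance arises as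
    -- a supremum of lower bounds instead of an infimum of radii.
    LowerBound : Space X → Pred Carrier 0ℓ
    LowerBound x r = r ≤ 1# ×
      (∀ y → C y → ∀ ε → 0# < ε → Close ε (proj₁ x) (proj₁ y) → r ≤ ε)

    0-lowerBound : ∀ x → LowerBound x 0#
    0-lowerBound x = proj₁ 0<1 , λ _ _ _ 0<ε _ → proj₁ 0<ε

    -- The truncation at 1 makes the distance to the empty set meaningful.
    distance-sup : ∀ x →
      ∃[ s ] UpperBound (LowerBound x) s × (∀ b → UpperBound (LowerBound x) b → s ≤ b)
    distance-sup x = supremum (LowerBound x) (0# , 0-lowerBound x) (1# , λ _ → proj₁)

    distance : Space X → Carrier
    distance x = proj₁ (distance-sup x)

    distance-upper : ∀ x {r} → LowerBound x r → r ≤ distance x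
    distance-upper x {r} = proj₁ (proj₂ (distance-sup x)) r

    distance-least : ∀ x {b} → UpperBound (LowerBound x) b → distance x ≤ b
    distance-least x {b} = proj₂ (proj₂ (distance-sup x)) b

    0≤distance : ∀ x → 0# ≤ distance x
    0≤distance x = distance-upper x (0-lowerBound x)

    -- By the triangle inequality a point ε-close to `y` is (δ + ε)-close to `x`, so lowering a
    -- lower bound for `x` by δ gives one for `y`.
    distance-nonexpansive : ∀ {δ} → 0# < δ → ∀ x y →
      Close δ (proj₁ x) (proj₁ y) → distance x ≤ δ + distance y
    distance-nonexpansive {δ} 0<δ x y x~y = distance-least x λ r (r≤1 , r≤) → begin
      r               ≤⟨ x-y≤z⇒x≤z+y (distance-upper y (shift r≤1 r≤)) ⟩
      distance y + δ  ≈⟨ +-comm (distance y) δ ⟩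
      δ + distance y  ∎
      where
      -- The number r - δ may be negative, which `LowerBound` permits.
      shift : ∀ {r} → r ≤ 1# →
        (∀ z → C z → ∀ ε → 0# < ε → Close ε (proj₁ x) (proj₁ z) → r ≤ ε) →
        LowerBound y (r - δ)
      shift {r} r≤1 r≤ = x≤z+y⇒x-y≤z r≤1+δ , λ z z∈C ε 0<ε y~z → x≤z+y⇒x-y≤z (begin
          r      ≤⟨ r≤ z z∈C (δ + ε) (0<δ+ 0<ε) (Close-trans x~y y~z) ⟩
          δ + ε  ≈⟨ +-comm δ ε ⟩
          ε + δ  ∎)
        where
        r≤1+δ : r ≤ 1# + δ
        r≤1+δ = begin
          r       ≤⟨ r≤1 ⟩
          1#      <⟨ x<y+x 1# 0<δ ⟩
          δ + 1#  ≈⟨ +-comm δ 1# ⟩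
          1# + δ  ∎

        0<δ+ : ∀ {ε} → 0# < ε → 0# < δ + ε
        0<δ+ {ε} 0<ε = begin-strict
          0#     <⟨ 0<ε ⟩
          ε      <⟨ x<y+x ε 0<δ ⟩
          δ + ε  ∎

    ∈⇒distance≈0 : ∀ {x} → C x → distance x ≈ 0#
    ∈⇒distance≈0 {x} x∈C = ≤.antisym
      (distance-least x λ r (_ , r≤) → ≤-positive⇒≤0 λ ε 0<ε →
        r≤ x x∈C ε 0<ε (≈⇒Close 0<ε λ _ → refl))
      (0≤distance x)

    distance≈0⇒∈ : IsClosed C → ∀ {x} → distance x ≈ 0# → C x
    distance≈0⇒∈ closed {x} d≈0 = decidable-stable em λ x∉C →
      let ε , 0<ε , outside = closed x x∉C
          -- The ball of radius ε around `x` misses `C`, so ε is below every radius that reaches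
          -- `C`. The minimum with 1 respects the truncation and is still positive.
          bound : LowerBound x (ε ⊓ 1#)
          bound = x⊓y≤y ε 1# , λ y y∈C ε′ _ x~y → ≤.trans (x⊓y≤x ε 1#)
            (proj₁ (≰⇒> λ ε′≤ε → outside y (Close-mono ε′≤ε x~y) y∈C))
      in <⇒≱ (0<x⊓y 0<ε 0<1) (≤.trans (distance-upper x bound) (≤.reflexive d≈0))

-- Continuity of simplicial maps.

module SimplicialMapProperties (ℝ : CompleteOrderedField) where
  open CompleteOrderedField ℝ hiding (zero)
  open Geometry ℝ
  open OrderedFieldProperties ℝ
  open CommutativeMonoidSum +-commutativeMonoid using (sum; sum-cong-≋)
  open PartialOrderReasoning ≤.poset

  -- A point carries a membership proof on which `f` might depend; `linear` expresses the
  -- coordinates of `f x` through those of `x` alone.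
  simplicial⇒cong :
    ∀ {n m} {K : SimplicialComplex n} {L : SimplicialComplex m} {f : Space ∥ K ∥ → Space ∥ L ∥} →
    IsSimplicialMap K L f → ∀ {x y} → x ≃ y → f x ≃ f y
  simplicial⇒cong {f = f} simp {x} {y} x≃y w = begin-equality
    proj₁ (f x) w                                                 ≈⟨ linear x w ⟩
    sum (λ v → if does (vertexMap v ≟ w) then proj₁ x v else 0#)
      ≈⟨ sum-cong-≋ (λ v → select (does (vertexMap v ≟ w)) (x≃y v)) ⟩
    sum (λ v → if does (vertexMap v ≟ w) then proj₁ y v else 0#)  ≈⟨ linear y w ⟨
    proj₁ (f y) w                                                 ∎
    where
    open IsSimplicialMap simp

    select : (b : Bool) → ∀ {s t} → s ≈ t → (if b then s else 0#) ≈ (if b then t else 0#)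
    select true  s≈t = s≈t
    select false _   = refl

  -- Each coordinate of `f x` is a sum over at most n coordinates of `x`, so the δ of
  -- `sum-continuous` serves all coordinates and all points at once.
  simplicial⇒uniformlyContinuous :
    ∀ {n m} {K : SimplicialComplex n} {L : SimplicialComplex m} {f : Space ∥ K ∥ → Space ∥ L ∥} →
    IsSimplicialMap K L f → ∀ {ε} → 0# < ε →
    ∃[ δ ] 0# < δ × (∀ x y → Close δ (proj₁ x) (proj₁ y) → Close ε (proj₁ (f x)) (proj₁ (f y)))
  simplicial⇒uniformlyContinuous {n} {f = f} simp {ε} 0<ε with sum-continuous n 0<ε
  ... | δ , 0<δ , _ , bound = δ , 0<δ , λ x y x~y w →
          difference x y w (proj₁ ∘ x~y) , difference y x w (proj₂ ∘ x~y)
    where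
    open IsSimplicialMap simp

    select : (b : Bool) → ∀ {s t} → s - t < δ →
      (if b then s else 0#) < δ + (if b then t else 0#)
    select true  s-t<δ = x-y<z⇒x<z+y s-t<δ
    select false _     = x<y+x 0# 0<δ

    difference : ∀ x y w → (∀ v → proj₁ x v - proj₁ y v < δ) →
      proj₁ (f x) w - proj₁ (f y) w < ε
    difference x y w x-y<δ = x<z+y⇒x-y<z (begin-strict
      proj₁ (f x) w                                                  ≈⟨ linear x w ⟩
      sum (λ v → if does (vertexMap v ≟ w) then proj₁ x v else 0#)
        <⟨ bound _ _ (λ v → select (does (vertexMap v ≟ w)) (x-y<δ v)) ⟩
      ε + sum (λ v → if does (vertexMap v ≟ w) then proj₁ y v else 0#)
        ≈⟨ +-congˡ (linear y w) ⟨
      ε + proj₁ (f y) w                                              ∎)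

-- Walk from `j` down to index zero, then up to `i`. Both walks recurse on `P ∘ suc`; the hypothesis
-- shifts along because `inject₁ (suc i)` computes to `suc (inject₁ i)`.
neighbour-closed⇒all : ∀ {d} (P : Pred (Fin (suc d)) 0ℓ) →
  (∀ i → P (inject₁ i) ⇔ P (suc i)) → ∀ {j} → P j → ∀ i → P i
neighbour-closed⇒all P step {j} Pj i = from-zero P step (to-zero P step j Pj) i
  where
  open Equivalence

  to-zero : ∀ {d} (P : Pred (Fin (suc d)) 0ℓ) →
    (∀ i → P (inject₁ i) ⇔ P (suc i)) → ∀ j → P j → P zero
  to-zero P step zero P₀ = P₀
  to-zero {suc d} P step (suc j) Pj = step zero .from (to-zero (P ∘ suc) (step ∘ suc) j Pj)

  from-zero : ∀ {d} (P : Pred (Fin (suc d)) 0ℓ) →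
    (∀ i → P (inject₁ i) ⇔ P (suc i)) → P zero → ∀ i → P i
  from-zero P step P₀ zero = P₀
  from-zero {suc d} P step P₀ (suc i) = from-zero (P ∘ suc) (step ∘ suc) (step zero .to P₀) i

-- The Borsuk-Ulam argument for one set per index.

module Antipodal (em : ExcludedMiddle 0ℓ) (ℝ : CompleteOrderedField) {d : ℕ}
                 (X : Geometry.BUTManifold ℝ d) where
  open CompleteOrderedField ℝ hiding (zero)
  open Geometry ℝ
  open BUTManifold X
  open OrderedFieldProperties ℝ
  open SimplicialMapProperties ℝ
  open Distance em ℝ {X = ∥ complex ∥}
  open Equivalence
  open PartialOrderReasoning ≤.poset

  module _ (C : Fin (suc d) → Pred Point 0ℓ) (closed : ∀ i → IsClosed (C i))
           (disjoint : ∀ i {x} → C i x → ¬ C i (A x)) where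

    -- The d + 1 sets form d consecutive pairs, matching the dimension of the target. Because of the
    -- `A` in the second argument, a coincidence links the membership of one and the same point in
    -- both sets of a pair.
    test-map : Point → ℝ^ d
    test-map x i = distance (C (inject₁ i)) x ⊓ distance (C (suc i)) (A x)

    test-map-continuous : IsContinuous test-map
    -- Nonexpansiveness gives only a weak inequality with slack η, so η is taken strictly below ε.
    -- The radius `η ⊓ δ` controls both `x` and `A x`.
    test-map-continuous x ε 0<ε with half< 0<ε
    ... | η , 0<η , η<ε with simplicial⇒uniformlyContinuous simplicial 0<η
    ... | δ , 0<δ , A-close = η ⊓ δ , 0<x⊓y 0<η 0<δ , λ y x~y i →
            near x y (Close-mono (x⊓y≤x η δ) x~y) (A-close x y (Close-mono (x⊓y≤y η δ) x~y)) i ,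
            near y x (Close-mono (x⊓y≤x η δ) (Close-sym x~y))
                 (A-close y x (Close-mono (x⊓y≤y η δ) (Close-sym x~y))) i
      where
      near : ∀ x y → Close η (proj₁ x) (proj₁ y) → Close η (proj₁ (A x)) (proj₁ (A y)) →
        ∀ i → test-map x i - test-map y i < ε
      near x y x~y Ax~Ay i = x<z+y⇒x-y<z (begin-strict
        test-map x i
          ≤⟨ ⊓-nonexpansive (distance-nonexpansive (C (inject₁ i)) 0<η x y x~y)
                            (distance-nonexpansive (C (suc i)) 0<η (A x) (A y) Ax~Ay) ⟩
        η + test-map y i  <⟨ +-monoˡ-< (test-map y i) η<ε ⟩
        ε + test-map y i  ∎)

    test-map-zero : ∀ i x → test-map x i ≈ 0# ⇔ (C (inject₁ i) x ⊎ C (suc i) (A x))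
    test-map-zero i x = mk⇔
      (Sum.map (distance≈0⇒∈ _ (closed (inject₁ i))) (distance≈0⇒∈ _ (closed (suc i)))
        ∘ x⊓y≈0⇒x≈0⊎y≈0)
      (x≈0⊎y≈0⇒x⊓y≈0 (0≤distance _ x) (0≤distance _ (A x))
        ∘ Sum.map (∈⇒distance≈0 _) (∈⇒distance≈0 _))

    module _ {x : Point} (coincident : ∀ i → test-map (A x) i ≈ test-map x i) where

      ∈-AA⇔∈ : ∀ i → C i (A (A x)) ⇔ C i x
      ∈-AA⇔∈ i = mk⇔ (IsClosed-resp-≃ (closed i) (involutive x))
                     (IsClosed-resp-≃ (closed i) (λ v → sym (involutive x v)))

      -- The two sides say that coordinate `i` of the test map vanishes at `x` and at `A x`, where
      -- its values agree. At `A x` the second set is tested at `A (A x)`, which is identified with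
      -- `x`.
      exchange : ∀ i → (C (inject₁ i) x ⊎ C (suc i) (A x)) ⇔ (C (inject₁ i) (A x) ⊎ C (suc i) x)
      exchange i = mk⇔
        (Sum.map₂ (∈-AA⇔∈ (suc i) .to) ∘ test-map-zero i (A x) .to
          ∘ trans (coincident i) ∘ test-map-zero i x .from)
        (test-map-zero i x .to ∘ trans (sym (coincident i))
          ∘ test-map-zero i (A x) .from ∘ Sum.map₂ (∈-AA⇔∈ (suc i) .from))

      here-step : ∀ i → C (inject₁ i) x ⇔ C (suc i) x
      here-step i = mk⇔ forward backward
        where
        forward : C (inject₁ i) x → C (suc i) x
        forward ∈C = fromInj₂ (λ A∈C → contradiction A∈C (disjoint (inject₁ i) ∈C))
                              (exchange i .to (inj₁ ∈C))

        backward : C (suc i) x → C (inject₁ i) x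
        backward ∈C = fromInj₁ (λ A∈C → contradiction A∈C (disjoint (suc i) ∈C))
                               (exchange i .from (inj₂ ∈C))

      there-step : ∀ i → C (inject₁ i) (A x) ⇔ C (suc i) (A x)
      there-step i = mk⇔ forward backward
        where
        forward : C (inject₁ i) (A x) → C (suc i) (A x)
        forward A∈C = fromInj₂ (λ ∈C → contradiction A∈C (disjoint (inject₁ i) ∈C))
                               (exchange i .from (inj₁ A∈C))

        backward : C (suc i) (A x) → C (inject₁ i) (A x)
        backward A∈C = fromInj₁ (λ ∈C → contradiction A∈C (disjoint (suc i) ∈C))
                                (exchange i .to (inj₂ A∈C))

      coincidence⇒common-point : ∃[ i ] (C i x ⊎ C i (A x)) → ∃[ y ] (∀ i → C i y)
      coincidence⇒common-point (_ , inj₁ ∈C) =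
        x , neighbour-closed⇒all (λ i → C i x) here-step ∈C
      coincidence⇒common-point (_ , inj₂ A∈C) =
        A x , neighbour-closed⇒all (λ i → C i (A x)) there-step A∈C

    -- This is the theorem with the signs removed: `C i` stands for the chosen member of the i-th
    -- pair, and its antipode enters only through `A x`.
    antipodal-cover⇒common-point : (∀ x → ∃[ i ] (C i x ⊎ C i (A x))) → ∃[ x ] (∀ i → C i x)
    antipodal-cover⇒common-point covers =
      let x , coincident = borsukUlam test-map test-map-continuous
      in coincidence⇒common-point coincident (covers x)

  -- From signed families to one set per index.

  module _ {m : ℕ} (B : SignedIndex m → Pred Point 0ℓ) (closed : ∀ i → IsClosed (B i))
           (antipodal : ∀ i → B (Sign.- , i) ≐ image A (B (Sign.+ , i))) where

    -- For the negative sign, `x` is `A y` with `y` in the positive set, so `A x` coincides with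
    -- `y`.
    ∈⇒A∈opposite : ∀ s i {x} → B (s , i) x → B (opposite s , i) (A x)
    ∈⇒A∈opposite Sign.+ i {x} x∈B = proj₂ (antipodal i) (x , x∈B , λ _ → refl)
    ∈⇒A∈opposite Sign.- i {x} x∈B with proj₁ (antipodal i) x∈B
    ... | y , y∈B , Ay≃x = IsClosed-resp-≃ (closed (Sign.+ , i)) y≃Ax y∈B
      where
      y≃Ax : y ≃ A x
      y≃Ax v = trans (sym (involutive y v)) (simplicial⇒cong simplicial Ay≃x v)

    A∈⇒∈opposite : ∀ s i {x} → B (s , i) (A x) → B (opposite s , i) x
    A∈⇒∈opposite s i {x} Ax∈B =
      IsClosed-resp-≃ (closed (opposite s , i)) (involutive x) (∈⇒A∈opposite s i Ax∈B)

    ∉-both : (∀ i x → ¬ (B (Sign.+ , i) x × B (Sign.- , i) x)) →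
      ∀ j {x} → B j x → ¬ B j (A x)
    ∉-both disjoint (Sign.+ , i) {x} x∈B Ax∈B = disjoint i x (x∈B , A∈⇒∈opposite Sign.+ i Ax∈B)
    ∉-both disjoint (Sign.- , i) {x} x∈B Ax∈B = disjoint i x (A∈⇒∈opposite Sign.- i Ax∈B , x∈B)

    -- If `s` is the sign of `j`, then `x` itself works; otherwise `A` moves it into the opposite
    -- set.
    ∈⇒∈⊎A∈ : ∀ s j {x} → B (s , absolute j) x → B j x ⊎ B j (A x)
    ∈⇒∈⊎A∈ Sign.+ (Sign.+ , i) x∈B = inj₁ x∈B
    ∈⇒∈⊎A∈ Sign.+ (Sign.- , i) x∈B = inj₂ (∈⇒A∈opposite Sign.+ i x∈B)
    ∈⇒∈⊎A∈ Sign.- (Sign.+ , i) x∈B = inj₂ (∈⇒A∈opposite Sign.- i x∈B)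
    ∈⇒∈⊎A∈ Sign.- (Sign.- , i) x∈B = inj₁ x∈B

theorem4p1 : ExcludedMiddle 0ℓ →
    (ℝ : CompleteOrderedField) →
    let open Geometry ℝ in
    (d : ℕ) (X : BUTManifold d) →
    let open BUTManifold X in
    (B : SignedIndex (suc d) → Pred Point 0ℓ) →
    (∀ i → IsClosed (B i)) →
    (∀ i → B (Sign.- , i) ≐ image A (B (Sign.+ , i))) →
    (∀ i → ∀ x → ¬ (B (Sign.+ , i) x × B (Sign.- , i) x)) →
    (∀ x → ∃[ i ] B i x) →
    (k : Fin (suc d) → SignedIndex (suc d)) →
    (∀ i → absolute (k i) ≡ i) →
    ∃[ x ] (∀ i → B (k i) x)
theorem4p1 em ℝ d X B closed antipodal disjoint covers k absolute-k =
  antipodal-cover⇒common-point (B ∘ k) (closed ∘ k) (∉-both B closed antipodal disjoint ∘ k) covers′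
  where
  open Geometry ℝ using (module BUTManifold)
  open BUTManifold X using (Point; A)
  open Antipodal em ℝ X

  covers′ : ∀ x → ∃[ i ] (B (k i) x ⊎ B (k i) (A x))
  covers′ x with covers x
  ... | (s , i) , x∈B = i ,
    -- The sign `s` found by the covering may differ from that of `k i`; only the absolute values
    -- agree, by `absolute-k`.
    ∈⇒∈⊎A∈ B closed antipodal s (k i) (subst (λ j → B (s , j) x) (≡-sym (absolute-k i)) x∈B)
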